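{- Let $D\ge2$ be squarefree and $K=\mathbb{Q}(\sqrt D)$ with discriminant $\Delta$. If $\alpha\in\mathcal{O}_K^+$ satisfies $p_K(\alpha\,|\,\mathcal{I})=2$, then \[ \mathrm{N}(\alpha) < 5\sqrt{\Delta}\left(\sqrt{\Delta}+1\right)\left(3\sqrt{\Delta}+2\right). \]
   Context: $\mathcal{O}_K^+$ is the set of totally positive elements of $\mathcal{O}_K$; $\mathrm{N}(\alpha)=\alpha\alpha'$ with $\alpha'$ the Galois conjugate. $\Delta=D$ if $D\equiv1\pmod4$, $\Delta=4D$ otherwise. An element of $\mathcal{O}_K^+$ is indecomposable if it is not a sum of two elements of $\mathcal{O}_K^+$. $p_K(\alpha\,|\,\mathcal{I})$ is the number of unordered representations of $\alpha$ as a sum $\lambda_1+\dots+\lambda_\ell$ ($\ell\ge1$) of indecomposables. -}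

module Defs where

open import Data.Nat as ℕ using (ℕ)
import Data.Nat.DivMod as ℕD
import Data.Nat.Divisibility as ℕDiv
open import Data.Integer using (ℤ; +_; _+_; _-_; _*_; _<_; 0ℤ)
open import Data.Integer.DivMod using (_/ℕ_)
open import Data.Integer.Divisibility using (_∣_)
open import Data.Product using (Σ; _×_; _,_)
open import Data.Sum using (_⊎_)
open import Data.List using (List; []; foldr)
open import Data.List.Relation.Unary.All using (All)
open import Data.List.Relation.Binary.Permutation.Propositional using (_↭_)
open import Relation.Nullary using (¬_)
open import Relation.Binary.PropositionalEquality using (_≡_; _≢_)

Squarefree : ℕ → Set
Squarefree D = (n : ℕ) → (n ℕ.* n) ℕDiv.∣ D → n ≡ 1

OneMod4 : ℕ → Set
OneMod4 D = D ℕD.% 4 ≡ 1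

disc : ℕ → ℕ
disc D with D ℕD.% 4
... | 1 = D
... | _ = 4 ℕ.* D

-- An element of K = Q(√D) of the form (x + y√D)/2 is represented by the
-- pair (x , y) of integers (this representation is unique).
Elt : Set
Elt = ℤ × ℤ

_⊕_ : Elt → Elt → Elt
(a , b) ⊕ (c , d) = (a + c , b + d)

zeroE : Elt
zeroE = (0ℤ , 0ℤ)

sumE : List Elt → Elt
sumE = foldr _⊕_ zeroE

InOK : ℕ → Elt → Set
InOK D (x , y) = (OneMod4 D × (+ 2 ∣ (x - y))) ⊎ (¬ OneMod4 D × (+ 2 ∣ x) × (+ 2 ∣ y))

-- totally positive: (x + y√D)/2 > 0 and (x - y√D)/2 > 0,
-- i.e. x > |y|√D, i.e. x > 0 and D y² < x²
TotPos : ℕ → Elt → Set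
TotPos D (x , y) = (0ℤ < x) × ((+ D) * y * y < x * x)

OKplus : ℕ → Elt → Set
OKplus D α = InOK D α × TotPos D α

-- norm N(α) = α α' = (x² - D y²)/4  (exact division for α ∈ O_K)
norm : ℕ → Elt → ℤ
norm D (x , y) = (x * x - (+ D) * y * y) /ℕ 4

Indecomposable : ℕ → Elt → Set
Indecomposable D α =
  OKplus D α × ¬ (Σ Elt λ β → Σ Elt λ γ → OKplus D β × OKplus D γ × α ≡ β ⊕ γ)

-- a representation of α as a sum λ₁ + … + λ_ℓ (ℓ ≥ 1) of indecomposables;
-- unordered representations = lists up to permutation (_↭_)
IsRep : ℕ → Elt → List Elt → Set
IsRep D α L = All (Indecomposable D) L × L ≢ [] × sumE L ≡ α

PK≡2 : ℕ → Elt → Set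
PK≡2 D α = Σ (List Elt) λ L₁ → Σ (List Elt) λ L₂ →
  IsRep D α L₁ × IsRep D α L₂ × ¬ (L₁ ↭ L₂) ×
  ((L : List Elt) → IsRep D α L → (L ↭ L₁) ⊎ (L ↭ L₂))

-- a < b √c  for integers a, naturals b, c  (real inequality, encoded exactly)
LtMulSqrt : ℤ → ℕ → ℕ → Set
LtMulSqrt a b c = (a < 0ℤ) ⊎ (a * a < + (b ℕ.* b ℕ.* c))

-- N < 5√Δ(√Δ+1)(3√Δ+2) = 25Δ + (15Δ+10)√Δ
--   ⇔  N - 25Δ < (15Δ+10)√Δ
NormBound : ℕ → ℤ → Set
NormBound Δ N = LtMulSqrt (N - + (25 ℕ.* Δ)) (15 ℕ.* Δ ℕ.+ 10) Δ

{-# OPTIONS --safe #-}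

-- Every totally positive α equals eβ + fγ with e, f ≥ 0 for a ℤ-basis (β, γ) of O_K
-- consisting of totally positive elements whose differences β - γ and γ - β are not totally
-- positive (subtract one from the other while possible); β and γ are then indecomposable.
-- If kβ - γ is totally positive and 2k ≤ e, then replacing kβ by γ + (kβ - γ) zero, one or
-- two times produces three different representations of α. Hence, with n = N(β), m = N(γ)
-- and t = Tr(βγ′), two representations force en < 2t + n and fm < 2t + m. Since
-- t² - 4nm = Δ and N(β - γ) < 0, that is n + m < t, these bounds control N(α).
module Submission where

open import Defs
open import Data.Nat using (ℕ; _≤_)
open import Data.Integer using (ℤ)
open import Data.Nat as ℕ using (zero; suc; s≤s; z≤n)
import Data.Nat.Properties as ℕₚ
import Data.Nat.DivMod as ℕD
import Data.Nat.Divisibility as ℕDiv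
open import Data.Nat.GCD using (gcd; gcd[m,n]∣m; gcd[m,n]∣n; gcd[m,n]≢0)
open import Data.Nat.Coprimality as Coprimality using (Coprime; coprime-/gcd; coprime-divisor)
open import Data.Integer as ℤ
  using (+_; -[1+_]; _+_; _-_; _*_; -_; _<_; 0ℤ; 1ℤ; -1ℤ; ∣_∣; +<+; -≤+; +≤+)
  renaming (_≤_ to _≤ᶻ_)
import Data.Integer.Properties as ℤₚ
open import Data.Integer.DivMod using ([n/ℕd]*d≤n)
open import Data.Integer.Divisibility.Signed using (divides; ∣ᵤ⇒∣; ∣⇒∣ᵤ)
open import Data.Integer.Tactic.RingSolver using (solve-∀)
open import Data.Product using (Σ; _×_; _,_; proj₁; proj₂)
open import Data.Sum using (_⊎_; inj₁; inj₂)
open import Data.Empty using (⊥-elim)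
open import Data.List using (List; []; _∷_; _++_; map; replicate)
open import Data.List.Properties using (map-++)
open import Data.List.Relation.Unary.All using (All; []; _∷_)
open import Data.List.Relation.Unary.All.Properties using (++⁺; replicate⁺)
open import Data.List.Relation.Binary.Permutation.Propositional using (_↭_; ↭-sym; ↭-trans)
open import Data.List.Relation.Binary.Permutation.Propositional.Properties using (map⁺)
open import Data.Nat.ListAction using (sum)
open import Data.Nat.ListAction.Properties using (sum-++; sum-↭)
open import Relation.Nullary using (¬_; Dec; yes; no)
open import Relation.Nullary.Decidable using (_×-dec_)
open import Relation.Binary.Definitions using (tri<; tri≈; tri>)
open import Relation.Binary.PropositionalEquality

-- The bound en < 2t + n originates in N(kβ - γ) = k(kn - t) + m, which is positive as soon as kn ≥
-- t; k = ⌊e/2⌋ is the largest value that 2k ≤ e allows. The remainder kβ - γ may well be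
-- decomposable, but being totally positive it lies in the scope of the same basis reduction, which
-- writes it as a sum of indecomposables. Coordinates are doubled, so traces carry a factor 2 and
-- norms a factor 4 until the integers n, m, t are extracted. The argument yields N(α) ≤ 25Δ +
-- 4Δ√(2Δ + 26), whose leading coefficient 4√2 lies well below the 15 of the claim; this slack is
-- why crude estimates suffice.

0≤*0≤ : ∀ {a b} → 0ℤ ≤ᶻ a → 0ℤ ≤ᶻ b → 0ℤ ≤ᶻ a * b
0≤*0≤ {+ m} {+ n} _ _ = subst (0ℤ ≤ᶻ_) (ℤₚ.pos-* m n) (+≤+ z≤n)

0<*0< : ∀ {a b} → 0ℤ < a → 0ℤ < b → 0ℤ < a * b
0<*0< (+<+ (s≤s _)) (+<+ (s≤s _)) = +<+ (s≤s z≤n)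

0≤a*a : ∀ a → 0ℤ ≤ᶻ a * a
0≤a*a (+ n) = 0≤*0≤ {+ n} {+ n} (+≤+ z≤n) (+≤+ z≤n)
0≤a*a -[1+ n ] = +≤+ z≤n

*-cancelˡ-0< : ∀ {a b} → 0ℤ ≤ᶻ a → 0ℤ < a * b → 0ℤ < b
*-cancelˡ-0< {+ m} {b} _ h =
  ℤₚ.*-cancelˡ-<-nonNeg (+ m) (subst (_< + m * b) (sym (ℤₚ.*-zeroʳ (+ m))) h)

-- Inequalities below are certified by an explicit nonnegative difference `c`, which reduces each of
-- them to a ring identity.
≤-by : ∀ {a b} c → 0ℤ ≤ᶻ c → b ≡ a + c → a ≤ᶻ b
≤-by {a} c h refl = subst (_≤ᶻ a + c) (ℤₚ.+-identityʳ a) (ℤₚ.+-monoʳ-≤ a h)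

<-by : ∀ {a b} c → 0ℤ < c → b ≡ a + c → a < b
<-by {a} c h refl = subst (_< a + c) (ℤₚ.+-identityʳ a) (ℤₚ.+-monoʳ-< a h)

<⇒0<- : ∀ {a b} → a < b → 0ℤ < b - a
<⇒0<- {a} {b} h = subst (_< b - a) (ℤₚ.+-inverseʳ a) (ℤₚ.+-monoˡ-< (- a) h)

square-cancel-< : ∀ {a b} → 0ℤ ≤ᶻ b → a * a < b * b → a < b
square-cancel-< {a} {b} 0≤b h with a ℤₚ.<? b
... | yes a<b = a<b
... | no a≮b = ⊥-elim (ℤₚ.<⇒≱ h (≤-by ((a - b) * (a - b) + + 2 * (b * (a - b)))
        (ℤₚ.+-mono-≤ (0≤a*a (a - b)) (0≤*0≤ {+ 2} (+≤+ z≤n) (0≤*0≤ 0≤b (ℤₚ.i≤j⇒0≤j-i (ℤₚ.≮⇒≥ a≮b)))))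
        (identity a b)))
  where
  identity : ∀ a b → a * a ≡ b * b + ((a - b) * (a - b) + + 2 * (b * (a - b)))
  identity = solve-∀

-- Linear combinations, the trace form, irrationality of √D

infixr 7 _·_
infixl 6 _⊝_

_·_ : ℤ → Elt → Elt
k · (x , y) = k * x , k * y

_⊝_ : Elt → Elt → Elt
α ⊝ β = α ⊕ (-1ℤ · β)

comb : ℤ → Elt → ℤ → Elt → Elt
comb i β j γ = (i · β) ⊕ (j · γ)

det : Elt → Elt → ℤ
det (x , y) (z , w) = x * w - y * z

-- For α = (x + y√D)/2 and β = (z + w√D)/2, polar (+ D) α β is 2 Tr(αβ′) and quad (+ D) α is 4 N(α).
polar : ℤ → Elt → Elt → ℤ
polar d (x , y) (z , w) = x * z - d * y * w

quad : ℤ → Elt → ℤ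
quad d α = polar d α α

-- In lowest terms the denominator divides the numerator, hence is 1, and D is a perfect square. A
-- squarefree perfect square is 1, against 2 ≤ D.
irrational : ∀ D → 2 ≤ D → Squarefree D → ∀ x y → x ℕ.* x ≡ D ℕ.* (y ℕ.* y) → y ≡ 0
irrational D 2≤D squarefree x zero _ = refl
irrational D 2≤D squarefree x y@(suc _) eq = ⊥-elim (ℕₚ.<⇒≢ 2≤D (sym (trans (sym D≡x₀²) (cong (λ z → z ℕ.* z) x₀≡1))))
  where
  g = gcd x y
  instance
    g≢0 : ℕ.NonZero g
    g≢0 = ℕ.≢-nonZero (gcd[m,n]≢0 x y (inj₂ λ ()))
    g²≢0 : ℕ.NonZero (g ℕ.* g)
    g²≢0 = ℕₚ.m*n≢0 g g
  x₀ = x ℕD./ g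
  y₀ = y ℕD./ g
  x≡ : x ≡ x₀ ℕ.* g
  x≡ = sym (ℕD.m/n*n≡m (gcd[m,n]∣m x y))
  y≡ : y ≡ y₀ ℕ.* g
  y≡ = sym (ℕD.m/n*n≡m (gcd[m,n]∣n x y))
  x₀²≡Dy₀² : x₀ ℕ.* x₀ ≡ D ℕ.* (y₀ ℕ.* y₀)
  x₀²≡Dy₀² = ℕₚ.*-cancelʳ-≡ _ _ (g ℕ.* g) (begin
    (x₀ ℕ.* x₀) ℕ.* (g ℕ.* g)          ≡⟨ ℕₚ.[m*n]*[o*p]≡[m*o]*[n*p] x₀ x₀ g g ⟩
    (x₀ ℕ.* g) ℕ.* (x₀ ℕ.* g)          ≡⟨ cong (λ z → z ℕ.* z) (sym x≡) ⟩
    x ℕ.* x                            ≡⟨ eq ⟩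
    D ℕ.* (y ℕ.* y)                    ≡⟨ cong (λ z → D ℕ.* (z ℕ.* z)) y≡ ⟩
    D ℕ.* ((y₀ ℕ.* g) ℕ.* (y₀ ℕ.* g))  ≡⟨ cong (D ℕ.*_) (ℕₚ.[m*n]*[o*p]≡[m*o]*[n*p] y₀ g y₀ g) ⟩
    D ℕ.* ((y₀ ℕ.* y₀) ℕ.* (g ℕ.* g))  ≡⟨ sym (ℕₚ.*-assoc D (y₀ ℕ.* y₀) (g ℕ.* g)) ⟩
    (D ℕ.* (y₀ ℕ.* y₀)) ℕ.* (g ℕ.* g)  ∎)
    where open ≡-Reasoning
  coprime : Coprime x₀ y₀
  coprime = coprime-/gcd x y
  y₀∣x₀ : y₀ ℕDiv.∣ x₀
  y₀∣x₀ = coprime-divisor (Coprimality.sym coprime)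
    (ℕDiv.divides (D ℕ.* y₀) (trans x₀²≡Dy₀² (sym (ℕₚ.*-assoc D y₀ y₀))))
  y₀≡1 : y₀ ≡ 1
  y₀≡1 = coprime (y₀∣x₀ , ℕDiv.∣-refl)
  D≡x₀² : x₀ ℕ.* x₀ ≡ D
  D≡x₀² = trans x₀²≡Dy₀² (trans (cong (λ z → D ℕ.* (z ℕ.* z)) y₀≡1) (ℕₚ.*-identityʳ D))
  x₀≡1 : x₀ ≡ 1
  x₀≡1 = squarefree x₀ (ℕDiv.∣-reflexive D≡x₀²)

-- The numerical estimate

*-mono-nonNeg : ∀ {a b A B} → 0ℤ ≤ᶻ a → 0ℤ ≤ᶻ B → a ≤ᶻ A → b ≤ᶻ B → a * b ≤ᶻ A * B
*-mono-nonNeg {a} {b} {A} {B} 0≤a 0≤B a≤A b≤B =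
  ≤-by _ (ℤₚ.+-mono-≤ (0≤*0≤ (ℤₚ.i≤j⇒0≤j-i a≤A) 0≤B) (0≤*0≤ 0≤a (ℤₚ.i≤j⇒0≤j-i b≤B))) (identity a b A B)
  where
  identity : ∀ a b A B → A * B ≡ a * b + ((A - a) * B + a * (B - b))
  identity = solve-∀

0<⇒0≤-1 : ∀ {i} → 0ℤ < i → 0ℤ ≤ᶻ i - 1ℤ
0<⇒0≤-1 (+<+ (s≤s _)) = +≤+ z≤n

-- With P = nm and u = n + m, the hypotheses give P N ≤ 4t³ + 6t²u + 9tP + Pu, and t² = Δ + 4P,
-- u ≤ 2P, t + u ≤ Δ turn this into P (N - 25Δ) ≤ 4Δ (t + 3P). Squaring and
-- (t + 3P)² ≤ 2t² + 18P² ≤ P² (2Δ + 26) conclude.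
module NormEstimate (n m t e f N : ℤ) (0<n : 0ℤ < n) (0<m : 0ℤ < m) (n+m<t : n + m < t)
  (0≤e : 0ℤ ≤ᶻ e) (0≤f : 0ℤ ≤ᶻ f) (en≤ : e * n ≤ᶻ + 2 * t + n) (fm≤ : f * m ≤ᶻ + 2 * t + m)
  (N≤ : N ≤ᶻ e * e * n + e * f * t + f * f * m) where

  private
    P Δ M A B : ℤ
    P = n * m
    Δ = t * t - + 4 * P
    M = N - + 25 * Δ
    A = + 2 * t + n
    B = + 2 * t + m

    0<P : 0ℤ < P
    0<P = 0<*0< 0<n 0<m
    0≤P : 0ℤ ≤ᶻ P
    0≤P = ℤₚ.<⇒≤ 0<P
    0≤n = ℤₚ.<⇒≤ 0<n
    0≤m = ℤₚ.<⇒≤ 0<m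
    0<t : 0ℤ < t
    0<t = ℤₚ.<-trans (ℤₚ.+-mono-< 0<n 0<m) n+m<t
    0≤t = ℤₚ.<⇒≤ 0<t
    0≤A : 0ℤ ≤ᶻ A
    0≤A = ℤₚ.+-mono-≤ (0≤*0≤ {+ 2} (+≤+ z≤n) 0≤t) 0≤n
    0≤B : 0ℤ ≤ᶻ B
    0≤B = ℤₚ.+-mono-≤ (0≤*0≤ {+ 2} (+≤+ z≤n) 0≤t) 0≤m
    0≤en = 0≤*0≤ 0≤e 0≤n
    0≤fm = 0≤*0≤ 0≤f 0≤m

    -- The hypotheses bound en and fm rather than e and f. Multiplying the norm form by nm makes it
    -- a polynomial in en and fm with nonnegative coefficients, so both bounds can be inserted.
    PN≤ : P * N ≤ᶻ A * A * m + A * B * t + B * B * n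
    PN≤ = ℤₚ.≤-trans (*-mono-nonNeg 0≤P 0≤norm ℤₚ.≤-refl N≤)
      (subst (_≤ᶻ A * A * m + A * B * t + B * B * n) (identity n m t e f)
        (ℤₚ.+-mono-≤ (ℤₚ.+-mono-≤
          (*-mono-nonNeg (0≤*0≤ 0≤en 0≤en) 0≤m (*-mono-nonNeg 0≤en 0≤A en≤ en≤) ℤₚ.≤-refl)
          (*-mono-nonNeg (0≤*0≤ 0≤en 0≤fm) 0≤t (*-mono-nonNeg 0≤en 0≤B en≤ fm≤) ℤₚ.≤-refl))
          (*-mono-nonNeg (0≤*0≤ 0≤fm 0≤fm) 0≤n (*-mono-nonNeg 0≤fm 0≤B fm≤ fm≤) ℤₚ.≤-refl)))
      where
      0≤norm : 0ℤ ≤ᶻ e * e * n + e * f * t + f * f * m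
      0≤norm = ℤₚ.+-mono-≤ (ℤₚ.+-mono-≤ (0≤*0≤ (0≤*0≤ 0≤e 0≤e) 0≤n) (0≤*0≤ (0≤*0≤ 0≤e 0≤f) 0≤t))
                 (0≤*0≤ (0≤*0≤ 0≤f 0≤f) 0≤m)
      identity : ∀ n m t e f →
        (e * n) * (e * n) * m + (e * n) * (f * m) * t + (f * m) * (f * m) * n
        ≡ n * m * (e * e * n + e * f * t + f * f * m)
      identity = solve-∀

    0≤t-u-1 : 0ℤ ≤ᶻ t - (n + m) - 1ℤ
    0≤t-u-1 = 0<⇒0≤-1 (<⇒0<- n+m<t)

    -- With u = n + m, Δ = (t + u)(t - u) + (n - m)², and t - u ≥ 1 because these are integers.
    t+u≤Δ : t + (n + m) ≤ᶻ Δ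
    t+u≤Δ = ≤-by _ (ℤₚ.+-mono-≤
        (0≤*0≤ (ℤₚ.+-mono-≤ 0≤t (ℤₚ.+-mono-≤ 0≤n 0≤m)) 0≤t-u-1)
        (0≤a*a (n - m)))
      (identity n m t)
      where
      identity : ∀ n m t → t * t - + 4 * (n * m)
        ≡ t + (n + m) + ((t + (n + m)) * (t - (n + m) - 1ℤ) + (n - m) * (n - m))
      identity = solve-∀

    0<Δ : 0ℤ < Δ
    0<Δ = ℤₚ.<-≤-trans (ℤₚ.+-mono-< 0<t (ℤₚ.+-mono-< 0<n 0<m)) t+u≤Δ
    0≤Δ = ℤₚ.<⇒≤ 0<Δ

    -- Substituting t² = Δ + 4P turns the bound for PN into 4tΔ + 6uΔ + 25P(t + u). The last term is
    -- at most 25PΔ, which is absorbed by the 25Δ subtracted in `M`; the middle one is at most 12PΔ.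
    PM≤ : P * M ≤ᶻ + 4 * Δ * (t + + 3 * P)
    PM≤ = ≤-by _ (ℤₚ.+-mono-≤ (ℤₚ.i≤j⇒0≤j-i PN≤) (ℤₚ.+-mono-≤
        (0≤*0≤ (0≤*0≤ {+ 6} (+≤+ z≤n) 0≤Δ) (ℤₚ.+-mono-≤ (0≤*0≤ (0<⇒0≤-1 0<n) 0≤m) (0≤*0≤ 0≤n (0<⇒0≤-1 0<m))))
        (0≤*0≤ (0≤*0≤ {+ 25} (+≤+ z≤n) 0≤P) (ℤₚ.i≤j⇒0≤j-i t+u≤Δ))))
      (identity n m t N)
      where
      identity : ∀ n m t N →
        let P = n * m ; Δ = t * t - + 4 * P ; A = + 2 * t + n ; B = + 2 * t + m in
        + 4 * Δ * (t + + 3 * P) ≡ P * (N - + 25 * Δ)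
          + ((A * A * m + A * B * t + B * B * n - P * N)
            + (+ 6 * Δ * ((n - 1ℤ) * m + n * (m - 1ℤ)) + + 25 * P * (Δ - (t + (n + m)))))
      identity = solve-∀

    [t+3P]²≤ : (t + + 3 * P) * (t + + 3 * P) ≤ᶻ P * P * (+ 2 * Δ + + 26)
    [t+3P]²≤ = ≤-by _ (ℤₚ.+-mono-≤ (0≤a*a (t - + 3 * P))
        (0≤*0≤ (0<⇒0≤-1 0<P) (ℤₚ.+-mono-≤
          (0≤*0≤ (0≤*0≤ {+ 2} (+≤+ z≤n) 0≤Δ) (ℤₚ.+-mono-≤ {0ℤ} {P} {0ℤ} {1ℤ} 0≤P (+≤+ z≤n)))
          (0≤*0≤ {+ 8} (+≤+ z≤n) 0≤P))))
      (identity P t)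
      where
      identity : ∀ P t → let Δ = t * t - + 4 * P in
        P * P * (+ 2 * Δ + + 26) ≡ (t + + 3 * P) * (t + + 3 * P)
          + ((t - + 3 * P) * (t - + 3 * P) + (P - 1ℤ) * (+ 2 * Δ * (P + 1ℤ) + + 8 * P))
      identity = solve-∀

    -- The leading coefficients are 32 and 225. The difference Δ(193Δ² - 116Δ + 100) is regrouped
    -- around Δ - 1 so that Δ ≥ 1 makes every summand nonnegative.
    polynomial< : + 16 * (Δ * Δ) * (+ 2 * Δ + + 26) < (+ 15 * Δ + + 10) * (+ 15 * Δ + + 10) * Δ
    polynomial< = <-by _ (0<*0< 0<Δ (ℤₚ.+-mono-≤-< {0ℤ} {_} {0ℤ} {+ 100}
        (ℤₚ.+-mono-≤ (0≤*0≤ (0≤*0≤ {+ 193} (+≤+ z≤n) 0≤Δ) (0<⇒0≤-1 0<Δ)) (0≤*0≤ {+ 77} (+≤+ z≤n) 0≤Δ))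
        (+<+ (s≤s z≤n))))
      (identity Δ)
      where
      identity : ∀ Δ → (+ 15 * Δ + + 10) * (+ 15 * Δ + + 10) * Δ
        ≡ + 16 * (Δ * Δ) * (+ 2 * Δ + + 26) + Δ * (+ 193 * Δ * (Δ - 1ℤ) + + 77 * Δ + + 100)
      identity = solve-∀

  M²< : 0ℤ ≤ᶻ M → M * M < (+ 15 * Δ + + 10) * (+ 15 * Δ + + 10) * Δ
  M²< 0≤M = cancel (ℤₚ.≤-<-trans PM²≤ (scale polynomial<))
    where
    P² = P * P
    0<P² = 0<*0< 0<P 0<P
    cancel : ∀ {a b} → P² * a < P² * b → a < b
    cancel = ℤₚ.*-cancelˡ-<-nonNeg P² {{ℤ.nonNegative (ℤₚ.<⇒≤ 0<P²)}}
    scale : ∀ {a b} → a < b → P² * a < P² * b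
    scale = ℤₚ.*-monoˡ-<-pos P² {{ℤ.positive 0<P²}}
    identity₁ : ∀ P M → P * P * (M * M) ≡ (P * M) * (P * M)
    identity₁ = solve-∀
    identity₂ : ∀ Δ s → (+ 4 * Δ * s) * (+ 4 * Δ * s) ≡ + 16 * (Δ * Δ) * (s * s)
    identity₂ = solve-∀
    identity₃ : ∀ P Δ → + 16 * (Δ * Δ) * (P * P * (+ 2 * Δ + + 26)) ≡ P * P * (+ 16 * (Δ * Δ) * (+ 2 * Δ + + 26))
    identity₃ = solve-∀
    0≤PM = 0≤*0≤ 0≤P 0≤M
    0≤16Δ² : 0ℤ ≤ᶻ + 16 * (Δ * Δ)
    0≤16Δ² = 0≤*0≤ {+ 16} (+≤+ z≤n) (0≤a*a Δ)
    PM²≤ : P² * (M * M) ≤ᶻ P² * (+ 16 * (Δ * Δ) * (+ 2 * Δ + + 26))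
    PM²≤ = begin
      P² * (M * M)                                       ≡⟨ identity₁ P M ⟩
      (P * M) * (P * M)                                  ≤⟨ *-mono-nonNeg 0≤PM (ℤₚ.≤-trans 0≤PM PM≤) PM≤ PM≤ ⟩
      (+ 4 * Δ * (t + + 3 * P)) * (+ 4 * Δ * (t + + 3 * P)) ≡⟨ identity₂ Δ (t + + 3 * P) ⟩
      + 16 * (Δ * Δ) * ((t + + 3 * P) * (t + + 3 * P))   ≤⟨ *-mono-nonNeg 0≤16Δ² (ℤₚ.≤-trans (0≤a*a (t + + 3 * P)) [t+3P]²≤) ℤₚ.≤-refl [t+3P]²≤ ⟩
      + 16 * (Δ * Δ) * (P² * (+ 2 * Δ + + 26))           ≡⟨ identity₃ P Δ ⟩
      P² * (+ 16 * (Δ * Δ) * (+ 2 * Δ + + 26))           ∎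
      where open ℤₚ.≤-Reasoning

-- A negative N - 25Δ satisfies the first alternative of `LtMulSqrt`, so the comparison of squares
-- is only asked for where squaring preserves order.
intro-NormBound : ∀ Δ N →
  (0ℤ ≤ᶻ N - + 25 * + Δ →
   (N - + 25 * + Δ) * (N - + 25 * + Δ) < (+ 15 * + Δ + + 10) * (+ 15 * + Δ + + 10) * + Δ) →
  NormBound Δ N
intro-NormBound Δ N h with (N - + (25 ℕ.* Δ)) ℤₚ.<? 0ℤ
... | yes M<0 = inj₁ M<0
... | no M≮0 = inj₂ (subst₂ _<_ (cong₂ _*_ (sym cast-M) (sym cast-M)) (sym cast-bound)
                 (h (subst (0ℤ ≤ᶻ_) cast-M (ℤₚ.≮⇒≥ M≮0))))
  where
  cast-M : N - + (25 ℕ.* Δ) ≡ N - + 25 * + Δ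
  cast-M = cong (λ s → N - s) (ℤₚ.pos-* 25 Δ)
  c = 15 ℕ.* Δ ℕ.+ 10
  cast-c : + c ≡ + 15 * + Δ + + 10
  cast-c = cong (_+ + 10) (ℤₚ.pos-* 15 Δ)
  cast-bound : + (c ℕ.* c ℕ.* Δ) ≡ (+ 15 * + Δ + + 10) * (+ 15 * + Δ + + 10) * + Δ
  cast-bound = trans (ℤₚ.pos-* (c ℕ.* c) Δ) (cong (_* + Δ) (trans (ℤₚ.pos-* c c) (cong₂ _*_ cast-c cast-c)))

-- The ring of integers, uniformly in D modulo 4

-- O_K in the basis 1, (τ + σ√D)/2: σ = τ = 1 if D ≡ 1 (mod 4), and σ = 2, τ = 0 otherwise.
record Lattice (D : ℕ) : Set where
  field
    τ σ ν  : ℤ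
    disc≡  : + disc D ≡ + D * σ * σ
    disc≡′ : + D * σ * σ ≡ τ * τ - + 4 * ν
    coords : ∀ δ → InOK D δ → Σ ℤ λ a → Σ ℤ λ b → δ ≡ (+ 2 * a + τ * b , σ * b)
    inOK   : ∀ a b → InOK D (+ 2 * a + τ * b , σ * b)

disc-≡1 : ∀ D → OneMod4 D → disc D ≡ D
disc-≡1 D h with D ℕD.% 4
disc-≡1 D refl | _ = refl

disc-≢1 : ∀ D → ¬ OneMod4 D → disc D ≡ 4 ℕ.* D
disc-≢1 D h with D ℕD.% 4
... | 0 = refl
... | 1 = ⊥-elim (h refl)
... | suc (suc _) = refl

abstract
  -- Opaque: the two residue cases are seen later only through `τ`, `σ`, `ν`, the last two numbers
  -- of trace and norm type being τ = Tr and ν = N of (τ + σ√D)/2.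
  lattice : ∀ D → Lattice D
  lattice D with D ℕD.% 4 ℕ.≟ 1
  ... | yes h = record
    { τ = 1ℤ ; σ = 1ℤ ; ν = - (+ (D ℕD./ 4))
    ; disc≡ = trans (cong +_ (disc-≡1 D h)) (one² (+ D))
    ; disc≡′ = trans (sym (one² (+ D))) (trans D≡1+4c (neg (+ (D ℕD./ 4))))
    ; coords = coords
    ; inOK = λ a b → inj₁ (h , ∣⇒∣ᵤ (divides a (identity a b)))
    }
    where
    one² : ∀ x → x ≡ x * 1ℤ * 1ℤ
    one² = solve-∀
    neg : ∀ c → 1ℤ + c * + 4 ≡ 1ℤ * 1ℤ - + 4 * (- c)
    neg = solve-∀
    D≡1+4c : + D ≡ 1ℤ + + (D ℕD./ 4) * + 4
    D≡1+4c = trans (cong +_ (trans (ℕD.m≡m%n+[m/n]*n D 4) (cong (ℕ._+ D ℕD./ 4 ℕ.* 4) h)))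
               (cong (λ q → 1ℤ + q) (ℤₚ.pos-* (D ℕD./ 4) 4))
    identity : ∀ a b → (+ 2 * a + 1ℤ * b) - 1ℤ * b ≡ a * + 2
    identity = solve-∀
    coords : ∀ δ → InOK D δ → Σ ℤ λ a → Σ ℤ λ b → δ ≡ (+ 2 * a + 1ℤ * b , 1ℤ * b)
    coords _ (inj₂ (¬h , _)) = ⊥-elim (¬h h)
    coords (x , y) (inj₁ (_ , 2∣x-y)) with ∣ᵤ⇒∣ {+ 2} {x - y} 2∣x-y
    ... | divides q eq = q , y , cong₂ _,_ (trans (split x y) (trans (cong (λ i → i + y) eq) (collect q y)))
                                           (sym (ℤₚ.*-identityˡ y))
      where
      split : ∀ x y → x ≡ (x - y) + y
      split = solve-∀
      collect : ∀ q y → q * + 2 + y ≡ + 2 * q + 1ℤ * y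
      collect = solve-∀
  ... | no ¬h = record
    { τ = 0ℤ ; σ = + 2 ; ν = - (+ D)
    ; disc≡ = trans (cong +_ (disc-≢1 D ¬h)) (trans (ℤₚ.pos-* 4 D) (identity₁ (+ D)))
    ; disc≡′ = identity₂ (+ D)
    ; coords = coords
    ; inOK = λ a b → inj₂ (¬h , ∣⇒∣ᵤ (divides a (identity₃ a b)) , ∣⇒∣ᵤ (divides b (ℤₚ.*-comm (+ 2) b)))
    }
    where
    identity₁ : ∀ x → + 4 * x ≡ x * + 2 * + 2
    identity₁ = solve-∀
    identity₂ : ∀ x → x * + 2 * + 2 ≡ 0ℤ * 0ℤ - + 4 * (- x)
    identity₂ = solve-∀
    identity₃ : ∀ a b → + 2 * a + 0ℤ * b ≡ a * + 2
    identity₃ = solve-∀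
    coords : ∀ δ → InOK D δ → Σ ℤ λ a → Σ ℤ λ b → δ ≡ (+ 2 * a + 0ℤ * b , + 2 * b)
    coords _ (inj₁ (h , _)) = ⊥-elim (¬h h)
    coords (x , y) (inj₂ (_ , 2∣x , 2∣y)) with ∣ᵤ⇒∣ {+ 2} {x} 2∣x | ∣ᵤ⇒∣ {+ 2} {y} 2∣y
    ... | divides p eq | divides q eq′ =
      p , q , cong₂ _,_ (trans eq (sym (identity₃ p q))) (trans eq′ (ℤₚ.*-comm q (+ 2)))

-- Combinations under change of basis

comb-1k : ∀ k β γ → comb 1ℤ β k γ ≡ β ⊕ (k · γ)
comb-1k k (x , y) (z , w) = cong₂ _,_ (identity k x z) (identity k y w)
  where
  identity : ∀ k x z → 1ℤ * x + k * z ≡ x + k * z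
  identity = solve-∀

comb-swap : ∀ i β j γ → comb i β j γ ≡ comb j γ i β
comb-swap i (x , y) j (z , w) = cong₂ _,_ (ℤₚ.+-comm (i * x) (j * z)) (ℤₚ.+-comm (i * y) (j * w))

comb-shear : ∀ k i β j γ → comb i β j γ ≡ comb (i + - k * j) β j (γ ⊕ (k · β))
comb-shear k i (x , y) j (z , w) = cong₂ _,_ (identity k i j x z) (identity k i j y w)
  where
  identity : ∀ k i j x z → i * x + j * z ≡ (i + - k * j) * x + j * (z + k * x)
  identity = solve-∀

comb-neg : ∀ i β j γ → comb i β j γ ≡ comb i β (- j) (-1ℤ · γ)
comb-neg i (x , y) j (z , w) = cong₂ _,_ (identity i j x z) (identity i j y w)
  where
  identity : ∀ i j x z → i * x + j * z ≡ i * x + (- j) * (-1ℤ * z)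
  identity = solve-∀

comb-⊝ : ∀ e β f γ → comb e β f γ ≡ comb e (β ⊝ γ) (e + f) γ
comb-⊝ e (x , y) f (z , w) = cong₂ _,_ (identity e f x z) (identity e f y w)
  where
  identity : ∀ e f x z → e * x + f * z ≡ e * (x + -1ℤ * z) + (e + f) * z
  identity = solve-∀

i≤+∣i∣ : ∀ i → i ≤ᶻ + ∣ i ∣
i≤+∣i∣ (+ n) = ℤₚ.≤-refl
i≤+∣i∣ -[1+ n ] = -≤+

-i≤+∣i∣ : ∀ i → - i ≤ᶻ + ∣ i ∣
-i≤+∣i∣ i = subst (- i ≤ᶻ_) (cong +_ (ℤₚ.∣-i∣≡∣i∣ i)) (i≤+∣i∣ (- i))

shrink : ∀ {fuel} x z → 0ℤ < z → x + z ≤ᶻ + suc fuel → (x + -1ℤ * z) + z ≤ᶻ + fuel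
shrink {fuel} x z 0<z h =
  subst (_≤ᶻ + fuel) (identity x z) (ℤₚ.i<j⇒i≤pred[j] (ℤₚ.<-≤-trans (<-by z 0<z refl) h))
  where
  identity : ∀ x z → x ≡ (x + -1ℤ * z) + z
  identity = solve-∀

-- Sums and weights of lists

sumE-++ : ∀ L M → sumE (L ++ M) ≡ sumE L ⊕ sumE M
sumE-++ [] M = sym (cong₂ _,_ (ℤₚ.+-identityˡ _) (ℤₚ.+-identityˡ _))
sumE-++ ((x , y) ∷ L) M = trans (cong ((x , y) ⊕_) (sumE-++ L M))
  (sym (cong₂ _,_ (ℤₚ.+-assoc x _ _) (ℤₚ.+-assoc y _ _)))

sumE-replicate : ∀ n β → sumE (replicate n β) ≡ + n · β
sumE-replicate zero β = refl
sumE-replicate (suc n) β@(x , y) = trans (cong (β ⊕_) (sumE-replicate n β))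
  (cong₂ _,_ (identity (+ n) x) (identity (+ n) y))
  where
  identity : ∀ n x → x + n * x ≡ (1ℤ + n) * x
  identity = solve-∀

sumE-comb : ∀ e β f γ → sumE (replicate e β ++ replicate f γ) ≡ comb (+ e) β (+ f) γ
sumE-comb e β f γ = trans (sumE-++ (replicate e β) (replicate f γ))
  (cong₂ _⊕_ (sumE-replicate e β) (sumE-replicate f γ))

-- Tells the representations apart: elements proportional to β have weight zero.
weight : Elt → List Elt → ℕ
weight β L = sum (map (λ δ → ∣ det β δ ∣) L)

weight-↭ : ∀ β {L M} → L ↭ M → weight β L ≡ weight β M
weight-↭ β p = sum-↭ (map⁺ (λ δ → ∣ det β δ ∣) p)

weight-++ : ∀ β L M → weight β (L ++ M) ≡ weight β L ℕ.+ weight β M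
weight-++ β L M = trans (cong sum (map-++ (λ δ → ∣ det β δ ∣) L M)) (sum-++ (map _ L) (map _ M))

weight-replicate : ∀ β n → weight β (replicate n β) ≡ 0
weight-replicate β zero = refl
weight-replicate β@(x , y) (suc n) = cong₂ ℕ._+_ (cong ∣_∣ (identity x y)) (weight-replicate β n)
  where
  identity : ∀ x y → x * y - y * x ≡ 0ℤ
  identity = solve-∀

halve : ∀ e → Σ ℕ λ k → Σ ℕ λ r → r ≤ 1 × e ≡ r ℕ.+ (k ℕ.+ k)
halve zero = 0 , 0 , z≤n , refl
halve (suc zero) = 0 , 1 , s≤s z≤n , refl
halve (suc (suc e)) with halve e
... | k , r , r≤1 , refl = suc k , r , r≤1 ,
  sym (trans (cong (r ℕ.+_) (ℕₚ.+-suc (suc k) k)) (trans (ℕₚ.+-suc r (suc (k ℕ.+ k))) (cong suc (ℕₚ.+-suc r (k ℕ.+ k)))))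

-- The cone of totally positive elements

module Order (D : ℕ) where

  private
    d : ℤ
    d = + D

  totPos : ∀ α → 0ℤ < proj₁ α → 0ℤ < quad d α → TotPos D α
  totPos (x , y) 0<x 0<q = 0<x , <-by _ 0<q (identity (x * x) (d * y * y))
    where
    identity : ∀ a b → a ≡ b + (a - b)
    identity = solve-∀

  totPos⇒0<quad : ∀ α → TotPos D α → 0ℤ < quad d α
  totPos⇒0<quad _ (_ , h) = <⇒0<- h

  totPos? : ∀ α → Dec (TotPos D α)
  totPos? (x , y) = (0ℤ ℤₚ.<? x) ×-dec (d * y * y ℤₚ.<? x * x)

  -- The inequalities D y² < x² and D w² < z² multiply to (D y w)² < (x z)², and x z > 0 allows the
  -- squares to be dropped.
  totPos-polar : ∀ α β → TotPos D α → TotPos D β → 0ℤ < polar d α β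
  totPos-polar (x , y) (z , w) (0<x , p) (0<z , q) =
    <⇒0<- (square-cancel-< (ℤₚ.<⇒≤ (0<*0< 0<x 0<z))
      (<-by _ (ℤₚ.+-mono-<-≤ (0<*0< (<⇒0<- p) (0<*0< 0<z 0<z))
                              (0≤*0≤ (0≤*0≤ {d} (+≤+ z≤n) (0≤a*a y)) (ℤₚ.<⇒≤ (<⇒0<- q))))
        (identity d x y z w)))
    where
    identity : ∀ d x y z w → (x * z) * (x * z) ≡ (d * y * w) * (d * y * w) +
      ((x * x - d * y * y) * (z * z) + d * (y * y) * (z * z - d * w * w))
    identity = solve-∀

  totPos-⊕ : ∀ α β → TotPos D α → TotPos D β → TotPos D (α ⊕ β)
  totPos-⊕ α@(x , y) β@(z , w) p q =
    totPos (α ⊕ β) (ℤₚ.+-mono-< (proj₁ p) (proj₁ q))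
      (subst (0ℤ <_) (identity d x y z w)
        (ℤₚ.+-mono-< (ℤₚ.+-mono-< (totPos⇒0<quad α p) (totPos⇒0<quad β q))
                     (0<*0< {+ 2} (+<+ (s≤s z≤n)) (totPos-polar α β p q))))
    where
    identity : ∀ d x y z w →
      (x * x - d * y * y) + (z * z - d * w * w) + + 2 * (x * z - d * y * w)
      ≡ (x + z) * (x + z) - d * (y + w) * (y + w)
    identity = solve-∀

  totPos-· : ∀ k α → 0ℤ < k → TotPos D α → TotPos D (k · α)
  totPos-· k α@(x , y) 0<k p =
    totPos (k · α) (0<*0< 0<k (proj₁ p))
      (subst (0ℤ <_) (identity d k x y) (0<*0< (0<*0< 0<k 0<k) (totPos⇒0<quad α p)))
    where
    identity : ∀ d k x y → k * k * (x * x - d * y * y) ≡ (k * x) * (k * x) - d * (k * y) * (k * y)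
    identity = solve-∀

  -- The value k = 0 is harmless, since 0 · α is not totally positive. This lets the lemma be
  -- applied to coefficients known only to be nonnegative.
  totPos-·⁻¹ : ∀ k α → 0ℤ ≤ᶻ k → TotPos D (k · α) → TotPos D α
  totPos-·⁻¹ k α@(x , y) 0≤k p =
    totPos α (*-cancelˡ-0< 0≤k (proj₁ p))
      (*-cancelˡ-0< (0≤*0≤ 0≤k 0≤k)
        (subst (0ℤ <_) (identity d k x y) (totPos⇒0<quad (k · α) p)))
    where
    identity : ∀ d k x y → (k * x) * (k * x) - d * (k * y) * (k * y) ≡ k * k * (x * x - d * y * y)
    identity = solve-∀

  totPos-⊕-· : ∀ k α β → 0ℤ ≤ᶻ k → TotPos D α → TotPos D β → TotPos D (α ⊕ (k · β))
  totPos-⊕-· (+ zero) (x , y) (z , w) _ p _ =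
    subst (TotPos D) (sym (cong₂ _,_ (identity x z) (identity y w))) p
    where
    identity : ∀ a b → a + 0ℤ * b ≡ a
    identity = solve-∀
  totPos-⊕-· (+ suc k) α β _ p q =
    totPos-⊕ α (+ suc k · β) p (totPos-· (+ suc k) β (+<+ (s≤s z≤n)) q)

  -- A positive norm means that the two conjugates have the same sign, which is then the sign of the
  -- trace.
  0<quad⇒totPos± : ∀ α → 0ℤ < quad d α → TotPos D α ⊎ TotPos D (-1ℤ · α)
  0<quad⇒totPos± α@(x , y) h with ℤₚ.<-cmp 0ℤ x
  ... | tri< 0<x _ _ = inj₁ (totPos α 0<x h)
  ... | tri≈ _ refl _ = ⊥-elim (ℤₚ.<⇒≱ h
          (≤-by _ (0≤*0≤ {d} (+≤+ z≤n) (0≤a*a y)) (identity d y)))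
    where
    identity : ∀ d y → 0ℤ ≡ 0ℤ * 0ℤ - d * y * y + d * (y * y)
    identity = solve-∀
  ... | tri> _ _ x<0 = inj₂ (totPos (-1ℤ · α) (<-by _ (<⇒0<- x<0) (identity₁ x)) (subst (0ℤ <_) (identity₂ d x y) h))
    where
    identity₁ : ∀ x → -1ℤ * x ≡ 0ℤ + (0ℤ - x)
    identity₁ = solve-∀
    identity₂ : ∀ d x y → x * x - d * y * y ≡ (-1ℤ * x) * (-1ℤ * x) - d * (-1ℤ * y) * (-1ℤ * y)
    identity₂ = solve-∀

  -- Bases of O_K

  open Lattice (lattice D)

  inOK-comb : ∀ i β j γ → InOK D β → InOK D γ → InOK D (comb i β j γ)
  inOK-comb i β j γ β∈ γ∈ with coords β β∈ | coords γ γ∈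
  ... | a , b , refl | a′ , b′ , refl =
    subst (InOK D) (cong₂ _,_ (identity₁ i j a a′ b b′ τ) (identity₂ i j b b′ σ))
      (inOK (i * a + j * a′) (i * b + j * b′))
    where
    identity₁ : ∀ i j a a′ b b′ τ → + 2 * (i * a + j * a′) + τ * (i * b + j * b′)
      ≡ i * (+ 2 * a + τ * b) + j * (+ 2 * a′ + τ * b′)
    identity₁ = solve-∀
    identity₂ : ∀ i j b b′ σ → σ * (i * b + j * b′) ≡ i * (σ * b) + j * (σ * b′)
    identity₂ = solve-∀

  inOK-shear : ∀ k β γ → InOK D β → InOK D γ → InOK D (β ⊕ (k · γ))
  inOK-shear k β γ β∈ γ∈ = subst (InOK D) (comb-1k k β γ) (inOK-comb 1ℤ β k γ β∈ γ∈)

  -- (β, γ) is a ℤ-basis of O_K; since coordinates are doubled, D det² is 4Δ rather than Δ.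
  record Frame (β γ : Elt) : Set where
    field
      inβ  : InOK D β
      inγ  : InOK D γ
      span : ∀ δ → InOK D δ → Σ ℤ λ i → Σ ℤ λ j → δ ≡ comb i β j γ
      det² : + D * (det β γ * det β γ) ≡ + 4 * + disc D

  standardFrame : Frame (+ 2 , 0ℤ) (τ , σ)
  standardFrame = record
    { inβ = subst (InOK D) (cong₂ _,_ (identity₁ τ) (identity₂ σ)) (inOK 1ℤ 0ℤ)
    ; inγ = subst (InOK D) (cong₂ _,_ (identity₃ τ) (identity₄ σ)) (inOK 0ℤ 1ℤ)
    ; span = span
    ; det² = trans (identity₅ (+ D) τ σ) (cong (+ 4 *_) (sym disc≡))
    }
    where
    identity₁ : ∀ τ → + 2 * 1ℤ + τ * 0ℤ ≡ + 2
    identity₁ = solve-∀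
    identity₂ : ∀ σ → σ * 0ℤ ≡ 0ℤ
    identity₂ = solve-∀
    identity₃ : ∀ τ → + 2 * 0ℤ + τ * 1ℤ ≡ τ
    identity₃ = solve-∀
    identity₄ : ∀ σ → σ * 1ℤ ≡ σ
    identity₄ = solve-∀
    identity₅ : ∀ d τ σ → d * ((+ 2 * σ - 0ℤ * τ) * (+ 2 * σ - 0ℤ * τ)) ≡ + 4 * (d * σ * σ)
    identity₅ = solve-∀
    identity₆ : ∀ a b τ → + 2 * a + τ * b ≡ a * + 2 + b * τ
    identity₆ = solve-∀
    identity₇ : ∀ a b σ → σ * b ≡ a * 0ℤ + b * σ
    identity₇ = solve-∀
    span : ∀ δ → InOK D δ → Σ ℤ λ i → Σ ℤ λ j → δ ≡ comb i (+ 2 , 0ℤ) j (τ , σ)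
    span δ δ∈ with coords δ δ∈
    ... | a , b , refl = a , b , cong₂ _,_ (identity₆ a b τ) (identity₇ a b σ)

  swapFrame : ∀ {β γ} → Frame β γ → Frame γ β
  swapFrame {β@(x , y)} {γ@(z , w)} F = record
    { inβ = inγ ; inγ = inβ
    ; span = λ δ δ∈ → let i , j , eq = span δ δ∈ in j , i , trans eq (comb-swap i β j γ)
    ; det² = trans (identity (+ D) x y z w) det²
    }
    where
    open Frame F
    identity : ∀ d x y z w → d * ((z * y - w * x) * (z * y - w * x)) ≡ d * ((x * w - y * z) * (x * w - y * z))
    identity = solve-∀

  shearFrame : ∀ k β γ → Frame β γ → Frame β (γ ⊕ (k · β))
  shearFrame k β@(x , y) γ@(z , w) F = record
    { inβ = inβ ; inγ = inOK-shear k γ β inγ inβ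
    ; span = λ δ δ∈ → let i , j , eq = span δ δ∈ in i + - k * j , j , trans eq (comb-shear k i β j γ)
    ; det² = trans (identity (+ D) k x y z w) det²
    }
    where
    open Frame F
    identity : ∀ d k x y z w →
      d * ((x * (w + k * y) - y * (z + k * x)) * (x * (w + k * y) - y * (z + k * x)))
      ≡ d * ((x * w - y * z) * (x * w - y * z))
    identity = solve-∀

  negFrame : ∀ {β γ} → Frame β γ → Frame β (-1ℤ · γ)
  negFrame {β@(x , y)} {γ@(z , w)} F = record
    { inβ = inβ ; inγ = subst (InOK D) (cong₂ _,_ (identity₀ x z) (identity₀ y w)) (inOK-comb 0ℤ β -1ℤ γ inβ inγ)
    ; span = λ δ δ∈ → let i , j , eq = span δ δ∈ in i , - j , trans eq (comb-neg i β j γ)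
    ; det² = trans (identity (+ D) x y z w) det²
    }
    where
    open Frame F
    identity₀ : ∀ x z → 0ℤ * x + -1ℤ * z ≡ -1ℤ * z
    identity₀ = solve-∀
    identity : ∀ d x y z w →
      d * ((x * (-1ℤ * w) - y * (-1ℤ * z)) * (x * (-1ℤ * w) - y * (-1ℤ * z)))
      ≡ d * ((x * w - y * z) * (x * w - y * z))
    identity = solve-∀

  -- A basis containing a primitive divisor of α

  nonnegʳ : ∀ i {β} j {γ} → Frame β γ →
    Σ Elt λ γ′ → Frame β γ′ × Σ ℕ λ n → comb i β j γ ≡ comb i β (+ n) γ′
  nonnegʳ i (+ n) {γ} F = γ , F , n , refl
  nonnegʳ i {β} -[1+ n ] {γ} F = _ , negFrame F , suc n , comb-neg i β -[1+ n ] γ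

  nonnegFrame : ∀ i {β} j {γ} → Frame β γ →
    Σ Elt λ β′ → Σ Elt λ γ′ → Frame β′ γ′ ×
    Σ ℕ λ m → Σ ℕ λ n → comb i β j γ ≡ comb (+ m) β′ (+ n) γ′
  nonnegFrame i {β} j {γ} F =
    let γ′ , F′ , n , eq = nonnegʳ i j F
        β′ , F″ , m , eq′ = nonnegʳ (+ n) i (swapFrame F′)
    in β′ , γ′ , swapFrame F″ , m , n ,
       trans eq (trans (comb-swap i β (+ n) γ′) (trans eq′ (comb-swap (+ n) γ′ (+ m) β′)))

  -- The subtractive Euclidean algorithm on the coefficients: mu + (m + k)v = m(u + v) + kv, so each
  -- subtraction is compensated by a shear of the basis and the element itself never changes.
  euclid : ∀ fuel {u v} m n → m ℕ.+ n ℕ.≤ fuel → Frame u v →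
    Σ Elt λ u′ → Σ Elt λ v′ → Frame u′ v′ ×
    Σ ℕ λ g → comb (+ m) u (+ n) v ≡ comb (+ g) u′ 0ℤ v′
  euclid fuel {u} {v} m zero _ F = u , v , F , m , refl
  euclid fuel {u} {v} zero n _ F = v , u , swapFrame F , n , comb-swap 0ℤ u (+ n) v
  euclid (suc fuel) {u} {v} (suc m) (suc n) (s≤s m+n≤fuel) F with ℕₚ.≤-total m n
  ... | inj₁ m≤n with ℕₚ.m≤n⇒∃[o]m+o≡n m≤n
  ...   | k , refl =
    let u′ , v′ , F′ , g , eq = euclid fuel (suc m) k
          (ℕₚ.≤-trans (ℕₚ.≤-reflexive (sym (ℕₚ.+-suc m k))) (ℕₚ.≤-trans (ℕₚ.+-monoʳ-≤ m (s≤s (ℕₚ.m≤n+m k m))) m+n≤fuel))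
          (swapFrame (shearFrame 1ℤ v u (swapFrame F)))
    in u′ , v′ , F′ , g , trans (shear (+ suc m) (+ k) u v) eq
    where
    shear : ∀ m k u v → comb m u (m + k) v ≡ comb m (u ⊕ (1ℤ · v)) k v
    shear m k (x , y) (z , w) = cong₂ _,_ (identity m k x z) (identity m k y w)
      where
      identity : ∀ m k x z → m * x + (m + k) * z ≡ m * (x + 1ℤ * z) + k * z
      identity = solve-∀
  euclid (suc fuel) {u} {v} (suc m) (suc n) (s≤s m+n≤fuel) F | inj₂ n≤m with ℕₚ.m≤n⇒∃[o]m+o≡n n≤m
  ...   | k , refl =
    let u′ , v′ , F′ , g , eq = euclid fuel k (suc n)
          (ℕₚ.≤-trans (ℕₚ.+-monoˡ-≤ (suc n) (ℕₚ.m≤n+m k n)) m+n≤fuel)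
          (shearFrame 1ℤ u v F)
    in u′ , v′ , F′ , g , trans (shear (+ suc n) (+ k) u v) eq
    where
    shear : ∀ n k u v → comb (n + k) u n v ≡ comb k u n (v ⊕ (1ℤ · u))
    shear n k (x , y) (z , w) = cong₂ _,_ (identity n k x z) (identity n k y w)
      where
      identity : ∀ n k x z → (n + k) * x + n * z ≡ k * x + n * (z + 1ℤ * x)
      identity = solve-∀

  frameThrough : ∀ α → InOK D α →
    Σ Elt λ u → Σ Elt λ v → Frame u v × Σ ℕ λ g → α ≡ comb (+ g) u 0ℤ v
  frameThrough α α∈ =
    let i , j , eq = Frame.span standardFrame α α∈
        _ , _ , F , m , n , eq′ = nonnegFrame i j standardFrame
        u , v , F′ , g , eq″ = euclid (m ℕ.+ n) m n ℕₚ.≤-refl F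
    in u , v , F′ , g , trans eq (trans eq′ eq″)

  -- For k large, v + k u is dominated by k u: with K = 1 + |x_v| + |2T(u,v)| + |Q(v)|
  -- (T = polar, Q = quad),
  -- Q(v + K u) = K (K Q(u) + 2T(u,v)) + Q(v) and both Q(u) ≥ 1 and x_u ≥ 1.
  shearTotPos : ∀ u v → TotPos D u → Σ ℤ λ K → TotPos D (v ⊕ (K · u))
  shearTotPos u@(x , y) v@(z , w) p = K , totPos (v ⊕ (K · u)) 0<trace 0<norm
    where
    a = + ∣ z ∣
    b = + ∣ + 2 * polar d u v ∣
    c = + ∣ quad d v ∣
    K = 1ℤ + a + b + c
    0≤K : 0ℤ ≤ᶻ K
    0≤K = +≤+ z≤n
    0<trace : 0ℤ < z + K * x
    0<trace = <-by _
      (ℤₚ.+-mono-<-≤ {0ℤ} {1ℤ} (+<+ (s≤s z≤n))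
        (ℤₚ.+-mono-≤ (ℤₚ.+-mono-≤ {0ℤ} {b + c} (+≤+ z≤n) (ℤₚ.i≤j⇒0≤j-i (-i≤+∣i∣ z)))
                     (0≤*0≤ 0≤K (0<⇒0≤-1 (proj₁ p)))))
      (identity z x a b c)
      where
      identity : ∀ z x a b c → z + (1ℤ + a + b + c) * x
        ≡ 0ℤ + (1ℤ + ((b + c) + (a - - z) + (1ℤ + a + b + c) * (x - 1ℤ)))
      identity = solve-∀
    0<norm : 0ℤ < quad d (v ⊕ (K · u))
    0<norm = <-by _
      (ℤₚ.+-mono-<-≤ {0ℤ} {1ℤ} (+<+ (s≤s z≤n))
        (ℤₚ.+-mono-≤
          (ℤₚ.+-mono-≤ (ℤₚ.+-mono-≤ {0ℤ} {a + b} (+≤+ z≤n) (ℤₚ.i≤j⇒0≤j-i (-i≤+∣i∣ (quad d v))))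
            (0≤*0≤ 0≤K (ℤₚ.+-mono-≤ {0ℤ} {a + c} (+≤+ z≤n) (ℤₚ.i≤j⇒0≤j-i (-i≤+∣i∣ (+ 2 * polar d u v))))))
          (0≤*0≤ (0≤*0≤ 0≤K 0≤K) (0<⇒0≤-1 (totPos⇒0<quad u p)))))
      (identity d x y z w a b c)
      where
      identity : ∀ d x y z w a b c →
        let K = 1ℤ + a + b + c in
        (z + K * x) * (z + K * x) - d * (w + K * y) * (w + K * y)
        ≡ 0ℤ + (1ℤ + ((a + b) + (c - - (z * z - d * w * w))
          + K * (a + c + (b - - (+ 2 * (x * z - d * y * w))))
          + K * K * ((x * x - d * y * y) - 1ℤ)))
      identity = solve-∀

  -- This is integrality of Tr(βγ′): the two products of `τ` cancel once Dσ² is replaced by τ² - 4ν,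
  -- and an even expression is left.
  polar-even : ∀ β γ → InOK D β → InOK D γ → Σ ℤ λ t → polar d β γ ≡ + 2 * t
  polar-even β γ β∈ γ∈ with coords β β∈ | coords γ γ∈
  ... | a , b , refl | a′ , b′ , refl = + 2 * (a * a′) + τ * (a * b′ + b * a′) + + 2 * ν * (b * b′) ,
    trans (identity₁ d τ σ a b a′ b′)
      (trans (cong (λ s → (+ 2 * a + τ * b) * (+ 2 * a′ + τ * b′) - s * b * b′) disc≡′) (identity₂ τ ν a b a′ b′))
    where
    identity₁ : ∀ d τ σ a b a′ b′ →
      (+ 2 * a + τ * b) * (+ 2 * a′ + τ * b′) - d * (σ * b) * (σ * b′)
      ≡ (+ 2 * a + τ * b) * (+ 2 * a′ + τ * b′) - d * σ * σ * b * b′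
    identity₁ = solve-∀
    identity₂ : ∀ τ ν a b a′ b′ →
      (+ 2 * a + τ * b) * (+ 2 * a′ + τ * b′) - (τ * τ - + 4 * ν) * b * b′
      ≡ + 2 * (+ 2 * (a * a′) + τ * (a * b′ + b * a′) + + 2 * ν * (b * b′))
    identity₂ = solve-∀

  quad-quadruple : ∀ β → InOK D β → Σ ℤ λ n → quad d β ≡ + 4 * n
  quad-quadruple β β∈ with coords β β∈
  ... | a , b , refl = a * a + τ * a * b + ν * b * b ,
    trans (identity₁ d τ σ a b)
      (trans (cong (λ s → (+ 2 * a + τ * b) * (+ 2 * a + τ * b) - s * b * b) disc≡′) (identity₂ τ ν a b))
    where
    identity₁ : ∀ d τ σ a b →
      (+ 2 * a + τ * b) * (+ 2 * a + τ * b) - d * (σ * b) * (σ * b)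
      ≡ (+ 2 * a + τ * b) * (+ 2 * a + τ * b) - d * σ * σ * b * b
    identity₁ = solve-∀
    identity₂ : ∀ τ ν a b →
      (+ 2 * a + τ * b) * (+ 2 * a + τ * b) - (τ * τ - + 4 * ν) * b * b
      ≡ + 4 * (a * a + τ * a * b + ν * b * b)
    identity₂ = solve-∀

  -- Reduction to a basis of indecomposables

  record Reduced (β γ : Elt) : Set where
    field
      frame  : Frame β γ
      pos₁   : TotPos D β
      pos₂   : TotPos D γ
      ¬β≻γ   : ¬ TotPos D (β ⊝ γ)
      ¬γ≻β   : ¬ TotPos D (γ ⊝ β)
    open Frame frame public

  swapReduced : ∀ {β γ} → Reduced β γ → Reduced γ β
  swapReduced B = record
    { frame = swapFrame frame ; pos₁ = pos₂ ; pos₂ = pos₁ ; ¬β≻γ = ¬γ≻β ; ¬γ≻β = ¬β≻γ }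
    where open Reduced B

  -- Since eβ + fγ = e(β - γ) + (e + f)γ, the coefficients stay nonnegative. The fuel bounds the sum
  -- of the two traces, which is positive and drops by the trace of the subtracted element.
  reduce : ∀ fuel β γ e f → Frame β γ → TotPos D β → TotPos D γ → proj₁ β + proj₁ γ ≤ᶻ + fuel →
    Σ Elt λ β′ → Σ Elt λ γ′ → Reduced β′ γ′ ×
    Σ ℕ λ e′ → Σ ℕ λ f′ → comb (+ e) β (+ f) γ ≡ comb (+ e′) β′ (+ f′) γ′
  reduce zero β γ e f F p q h = ⊥-elim (ℤₚ.<⇒≱ (ℤₚ.+-mono-< (proj₁ p) (proj₁ q)) h)
  reduce (suc fuel) β γ e f F p q h with totPos? (β ⊝ γ)
  ... | yes β≻γ =
    let β′ , γ′ , B , e′ , f′ , eq = reduce fuel (β ⊝ γ) γ e (e ℕ.+ f)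
          (swapFrame (shearFrame -1ℤ γ β (swapFrame F))) β≻γ q (shrink (proj₁ β) (proj₁ γ) (proj₁ q) h)
    in β′ , γ′ , B , e′ , f′ , trans (comb-⊝ (+ e) β (+ f) γ) eq
  ... | no ¬β≻γ with totPos? (γ ⊝ β)
  ...   | yes γ≻β =
    let β′ , γ′ , B , e′ , f′ , eq = reduce fuel (γ ⊝ β) β f (f ℕ.+ e)
          (swapFrame (shearFrame -1ℤ β γ F)) γ≻β p
          (shrink (proj₁ γ) (proj₁ β) (proj₁ p) (subst (_≤ᶻ + suc fuel) (ℤₚ.+-comm (proj₁ β) (proj₁ γ)) h))
    in β′ , γ′ , B , e′ , f′ ,
       trans (comb-swap (+ e) β (+ f) γ) (trans (comb-⊝ (+ f) γ (+ e) β) eq)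
  ...   | no ¬γ≻β = β , γ , record { frame = F ; pos₁ = p ; pos₂ = q ; ¬β≻γ = ¬β≻γ ; ¬γ≻β = ¬γ≻β }
                  , e , f , refl

  -- Writing α = gu with u in a basis (u, v) gives the nonnegative coefficients g and 0 to start
  -- from. Because v has coefficient 0, it can be made totally positive by adding a multiple of u
  -- without disturbing them.
  reducedFrame : ∀ α → OKplus D α →
    Σ Elt λ β → Σ Elt λ γ → Reduced β γ × Σ ℕ λ e → Σ ℕ λ f → α ≡ comb (+ e) β (+ f) γ
  reducedFrame α (α∈ , p) =
    let u , v , F , g , eq = frameThrough α α∈
        pᵤ = totPos-·⁻¹ (+ g) u (+≤+ z≤n) (subst (TotPos D) (trans eq (comb-k0 (+ g) u v)) p)
        K , pᵥ = shearTotPos u v pᵤ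
        v′ = v ⊕ (K · u)
        β , γ , B , e , f , eq′ = reduce ∣ proj₁ u + proj₁ v′ ∣ u v′ g 0
          (shearFrame K u v F) pᵤ pᵥ (i≤+∣i∣ (proj₁ u + proj₁ v′))
    in β , γ , B , e , f , trans (trans eq (trans (comb-k0 (+ g) u v) (sym (comb-k0 (+ g) u v′)))) eq′
    where
    comb-k0 : ∀ k u v → comb k u 0ℤ v ≡ k · u
    comb-k0 k (x , y) (z , w) = cong₂ _,_ (ℤₚ.+-identityʳ (k * x)) (ℤₚ.+-identityʳ (k * y))

  -- If β = δ + δ′ with δ = iβ + jγ and j ≥ 0, then (-i)β ≺ jγ ≺ (1-i)β.
  -- Comparing j with -i gives γ ≻ β or β ≻ γ.
  module _ {β γ} (B : Reduced β γ) where

    open Reduced B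

    straddle : ∀ i j → 0ℤ ≤ᶻ j → TotPos D (comb i β j γ) → ¬ TotPos D (comb (1ℤ - i) β (- j) γ)
    straddle i j 0≤j p q with j ℤ.≤? - i
    ... | yes j≤-i = ¬γ≻β (totPos-·⁻¹ j (γ ⊝ β) 0≤j (subst (TotPos D)
            (cong₂ _,_ (identity i j (proj₁ β) (proj₁ γ)) (identity i j (proj₂ β) (proj₂ γ)))
            (totPos-⊕-· (- i - j) (comb i β j γ) β (ℤₚ.i≤j⇒0≤j-i j≤-i) p pos₁)))
      where
      identity : ∀ i j x z → (i * x + j * z) + (- i - j) * x ≡ j * (z + -1ℤ * x)
      identity = solve-∀
    -- Integrality turns j > -i into j ≥ 1 - i, so no case remains between the two; adding a
    -- nonnegative multiple of β to the second summand gives j(β - γ).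
    ... | no j≰-i = ¬β≻γ (totPos-·⁻¹ j (β ⊝ γ) 0≤j (subst (TotPos D)
            (cong₂ _,_ (identity i j (proj₁ β) (proj₁ γ)) (identity i j (proj₂ β) (proj₂ γ)))
            (totPos-⊕-· (j - (1ℤ - i)) (comb (1ℤ - i) β (- j) γ) β
              (ℤₚ.i≤j⇒0≤j-i (ℤₚ.i<j⇒suc[i]≤j (ℤₚ.≰⇒> j≰-i))) q pos₁)))
      where
      identity : ∀ i j x z → ((1ℤ - i) * x + (- j) * z) + (j - (1ℤ - i)) * x ≡ j * (x + -1ℤ * z)
      identity = solve-∀

    complement : ∀ i j δ → β ≡ comb i β j γ ⊕ δ → δ ≡ comb (1ℤ - i) β (- j) γ
    complement i j δ eq = cong₂ _,_ (coordinate (proj₁ β) (proj₁ γ) (proj₁ δ) (cong proj₁ eq))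
                                    (coordinate (proj₂ β) (proj₂ γ) (proj₂ δ) (cong proj₂ eq))
      where
      identity₁ : ∀ a r → r ≡ (a + r) - a
      identity₁ = solve-∀
      identity₂ : ∀ i j x z → x - (i * x + j * z) ≡ (1ℤ - i) * x + (- j) * z
      identity₂ = solve-∀
      coordinate : ∀ x z r → x ≡ i * x + j * z + r → r ≡ (1ℤ - i) * x + (- j) * z
      coordinate x z r eq = trans (identity₁ (i * x + j * z) r)
        (trans (cong (λ s → s - (i * x + j * z)) (sym eq)) (identity₂ i j x z))

    indecomposable : Indecomposable D β
    indecomposable = (inβ , pos₁) , decomposition-absurd
      where
      double-complement : ∀ i j → comb i β j γ ≡ comb (1ℤ - (1ℤ - i)) β (- (- j)) γ
      double-complement i j = cong₂ _,_ (identity i j (proj₁ β) (proj₁ γ)) (identity i j (proj₂ β) (proj₂ γ))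
        where
        identity : ∀ i j x z → i * x + j * z ≡ (1ℤ - (1ℤ - i)) * x + (- (- j)) * z
        identity = solve-∀
      decomposition-absurd : ¬ (Σ Elt λ δ → Σ Elt λ δ′ → OKplus D δ × OKplus D δ′ × β ≡ δ ⊕ δ′)
      decomposition-absurd (δ , δ′ , (δ∈ , p) , (_ , p′) , eq) with span δ δ∈
      ... | i , j , refl with complement i j δ′ eq | 0ℤ ℤ.≤? j
      ...   | refl | yes 0≤j = straddle i j 0≤j p p′
      -- For negative j the summands exchange roles: the γ-coefficient of δ′ is -j.
      ...   | refl | no 0≰j = straddle (1ℤ - i) (- j) (ℤₚ.neg-mono-≤ (ℤₚ.<⇒≤ (ℤₚ.≰⇒> 0≰j))) p′
                                (subst (TotPos D) (double-complement i j) p)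

  -- Existence and coincidence of representations

  isRep : ∀ {α L} → TotPos D α → All (Indecomposable D) L → sumE L ≡ α → IsRep D α L
  isRep p all eq = all , (λ { refl → ℤₚ.<-irrefl (cong proj₁ eq) (proj₁ p) }) , eq

  module _ {β γ} (B : Reduced β γ) where

    all-comb : ∀ e f → All (Indecomposable D) (replicate e β ++ replicate f γ)
    all-comb e f = ++⁺ (replicate⁺ e (indecomposable B)) (replicate⁺ f (indecomposable (swapReduced B)))

  -- Used to split the remainder kβ - γ of the exchange into indecomposables.
  representation : ∀ α → OKplus D α → Σ (List Elt) (IsRep D α)
  representation α α∈⁺ =
    let β , γ , B , e , f , eq = reducedFrame α α∈⁺
    in _ , isRep (proj₂ α∈⁺) (all-comb B e f) (trans (sumE-comb e β f γ) (sym eq))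

  coincidence : ∀ {α L M N} → PK≡2 D α → IsRep D α L → IsRep D α M → IsRep D α N →
    L ↭ M ⊎ M ↭ N ⊎ L ↭ N
  coincidence {L = L} {M} {N} (_ , _ , _ , _ , _ , only) l m n with only L l | only M m | only N n
  ... | inj₁ p | inj₁ q | _      = inj₁ (↭-trans p (↭-sym q))
  ... | inj₂ p | inj₂ q | _      = inj₁ (↭-trans p (↭-sym q))
  ... | inj₁ p | inj₂ q | inj₁ r = inj₂ (inj₂ (↭-trans p (↭-sym r)))
  ... | inj₁ p | inj₂ q | inj₂ r = inj₂ (inj₁ (↭-trans q (↭-sym r)))
  ... | inj₂ p | inj₁ q | inj₁ r = inj₂ (inj₁ (↭-trans q (↭-sym r)))
  ... | inj₂ p | inj₁ q | inj₂ r = inj₂ (inj₂ (↭-trans p (↭-sym r)))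

  -- The exchange argument

  module _ (2≤D : 2 ≤ D) where

    0<disc : 0ℤ < + disc D
    0<disc with D ℕD.% 4 ℕ.≟ 1
    ... | yes h = subst (λ Δ → 0ℤ < + Δ) (sym (disc-≡1 D h)) (+<+ (ℕₚ.≤-trans (s≤s z≤n) 2≤D))
    ... | no ¬h = subst (λ Δ → 0ℤ < + Δ) (sym (disc-≢1 D ¬h))
                    (+<+ (ℕₚ.≤-trans (ℕₚ.≤-trans (s≤s z≤n) 2≤D) (ℕₚ.m≤m+n D _)))

    det≢0 : ∀ {β γ} → Frame β γ → det β γ ≢ 0ℤ
    det≢0 F eq = ℤₚ.<-irrefl (trans (sym (trans (cong (λ t → d * (t * t)) eq) (ℤₚ.*-zeroʳ d))) (Frame.det² F))
                   (0<*0< {+ 4} (+<+ (s≤s z≤n)) 0<disc)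

    -- `U` and `V` are two ways to write kβ. `U` has weight 0 and `V` a positive weight w, because
    -- it contains γ and det(β, γ) ≠ 0. Hence UU, UV and VV, each followed by `X`, have weights 0, w
    -- and 2w above that of `X`.
    exchange : ∀ {α β γ} → Reduced β γ → ∀ k r f → TotPos D ((+ k · β) ⊝ γ) → TotPos D α →
      α ≡ comb (+ (r ℕ.+ (k ℕ.+ k))) β (+ f) γ → ¬ PK≡2 D α
    exchange {α} {β} {γ} B k r f p pα eq pk2 = distinct (coincidence pk2 (rep partU partV) (rep partU partU) (rep partV partV))
      where
      open Reduced B
      kβ≻γ∈ : InOK D ((+ k · β) ⊝ γ)
      kβ≻γ∈ = inOK-comb (+ k) β -1ℤ γ inβ inγ
      R = proj₁ (representation ((+ k · β) ⊝ γ) (kβ≻γ∈ , p))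
      R-rep = proj₂ (representation ((+ k · β) ⊝ γ) (kβ≻γ∈ , p))
      U V X : List Elt
      U = replicate k β
      V = γ ∷ R
      X = replicate r β ++ replicate f γ

      Part : List Elt → Set
      Part M = All (Indecomposable D) M × sumE M ≡ + k · β
      partU : Part U
      partU = replicate⁺ k (indecomposable B) , sumE-replicate k β
      partV : Part V
      partV = indecomposable (swapReduced B) ∷ proj₁ R-rep ,
        trans (cong (γ ⊕_) (proj₂ (proj₂ R-rep)))
          (cong₂ _,_ (identity (+ k) (proj₁ β) (proj₁ γ)) (identity (+ k) (proj₂ β) (proj₂ γ)))
        where
        identity : ∀ k x z → z + (k * x + -1ℤ * z) ≡ k * x
        identity = solve-∀

      rep : ∀ {M N} → Part M → Part N → IsRep D α (M ++ (N ++ X))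
      rep {M} {N} (allM , sumM) (allN , sumN) =
        isRep pα (++⁺ allM (++⁺ allN (all-comb B r f)))
          (trans (trans (sumE-++ M (N ++ X)) (cong₂ _⊕_ sumM
             (trans (sumE-++ N X) (cong₂ _⊕_ sumN (sumE-comb r β f γ)))))
            (trans (cong₂ _,_ (identity (+ k) (+ r) (+ f) (proj₁ β) (proj₁ γ))
                              (identity (+ k) (+ r) (+ f) (proj₂ β) (proj₂ γ)))
              (sym eq)))
        where
        identity : ∀ k r f x z → k * x + (k * x + (r * x + f * z)) ≡ (r + (k + k)) * x + f * z
        identity = solve-∀

      wV≢0 : weight β V ≢ 0
      wV≢0 h = det≢0 frame (ℤₚ.∣i∣≡0⇒i≡0 (ℕₚ.m+n≡0⇒m≡0 _ h))

      weight≡ : ∀ M N → weight β (M ++ (N ++ X)) ≡ weight β M ℕ.+ (weight β N ℕ.+ weight β X)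
      weight≡ M N = trans (weight-++ β M (N ++ X)) (cong (weight β M ℕ.+_) (weight-++ β N X))

      wU≡0 : weight β U ≡ 0
      wU≡0 = weight-replicate β k

      same : ∀ {M N M′ N′} → M ++ (N ++ X) ↭ M′ ++ (N′ ++ X) →
        weight β M ℕ.+ (weight β N ℕ.+ weight β X) ≡ weight β M′ ℕ.+ (weight β N′ ℕ.+ weight β X)
      same {M} {N} {M′} {N′} q = trans (sym (weight≡ M N)) (trans (weight-↭ β q) (weight≡ M′ N′))

      cancel-w : ∀ a {b c} → a ℕ.+ (b ℕ.+ weight β X) ≡ a ℕ.+ (c ℕ.+ weight β X) → b ≡ c
      cancel-w a h = ℕₚ.+-cancelʳ-≡ (weight β X) _ _ (ℕₚ.+-cancelˡ-≡ a _ _ h)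

      distinct : ¬ (U ++ (V ++ X) ↭ U ++ (U ++ X) ⊎ U ++ (U ++ X) ↭ V ++ (V ++ X) ⊎ U ++ (V ++ X) ↭ V ++ (V ++ X))
      distinct (inj₁ q) = wV≢0 (trans (cancel-w (weight β U) (same {U} {V} {U} {U} q)) wU≡0)
      distinct (inj₂ (inj₁ q)) = wV≢0 (ℕₚ.m+n≡0⇒m≡0 _ (ℕₚ.+-cancelʳ-≡ (weight β X) _ 0
        (trans (ℕₚ.+-assoc (weight β V) (weight β V) (weight β X))
          (trans (sym (same {U} {U} {V} {V} q))
            (cong₂ (λ a b → a ℕ.+ (b ℕ.+ weight β X)) wU≡0 wU≡0)))))
      distinct (inj₂ (inj₂ q)) = wV≢0 (trans (sym
        (ℕₚ.+-cancelʳ-≡ (weight β V ℕ.+ weight β X) _ _ (same {U} {V} {V} {V} q))) wU≡0)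

    -- The hypothesis makes N(kβ - γ) positive, so kβ - γ or its negative is totally positive. In
    -- the second case k ≥ 1 would give γ ≻ β by adding (k - 1)β, and k = 0 contradicts positivity
    -- of Tr(βγ′).
    dominate : ∀ {β γ} → Reduced β γ → ∀ k → + 2 * polar d β γ ≤ᶻ + k * quad d β → TotPos D ((+ k · β) ⊝ γ)
    dominate {β} {γ} B k h with 0<quad⇒totPos± ((+ k · β) ⊝ γ) (subst (0ℤ <_)
        (identity d (+ k) (proj₁ β) (proj₂ β) (proj₁ γ) (proj₂ γ))
        (ℤₚ.+-mono-≤-< (0≤*0≤ {+ k} (+≤+ z≤n) (ℤₚ.i≤j⇒0≤j-i h)) (totPos⇒0<quad γ pos₂)))
      where
      open Reduced B
      identity : ∀ d k x y z w →
        k * (k * (x * x - d * y * y) - + 2 * (x * z - d * y * w)) + (z * z - d * w * w)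
        ≡ (k * x + -1ℤ * z) * (k * x + -1ℤ * z) - d * (k * y + -1ℤ * w) * (k * y + -1ℤ * w)
      identity = solve-∀
    ... | inj₁ p = p
    dominate {β} {γ} B zero h | inj₂ p =
      ⊥-elim (ℤₚ.<⇒≱ (0<*0< {+ 2} (+<+ (s≤s z≤n)) (totPos-polar β γ pos₁ pos₂)) h)
      where open Reduced B
    dominate {β} {γ} B (suc k) h | inj₂ p =
      ⊥-elim (¬γ≻β (subst (TotPos D)
        (cong₂ _,_ (identity (+ k) (proj₁ β) (proj₁ γ)) (identity (+ k) (proj₂ β) (proj₂ γ)))
        (totPos-⊕-· (+ k) (-1ℤ · ((+ suc k · β) ⊝ γ)) β (+≤+ z≤n) p pos₁)))
      where
      open Reduced B
      identity : ∀ k x z → -1ℤ * ((1ℤ + k) * x + -1ℤ * z) + k * x ≡ z + -1ℤ * x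
      identity = solve-∀

    -- For k = ⌊e/2⌋ the exchange must be impossible, which bounds 2k copies of `quad d β` by 4
    -- `polar d β γ`; the parity bit `r` accounts for the additional `quad d β`.
    coefficient< : ∀ {α β γ} → Reduced β γ → ∀ e f → TotPos D α → α ≡ comb (+ e) β (+ f) γ → PK≡2 D α →
      + e * quad d β < + 4 * polar d β γ + quad d β
    coefficient< {α} {β} {γ} B e f p eq pk2 with halve e
    ... | k , r , r≤1 , refl with + 2 * polar d β γ ℤ.≤? + k * quad d β
    ...   | yes h = ⊥-elim (exchange B k r f (dominate B k h) p eq pk2)
    ...   | no ¬h = <-by _ (ℤₚ.+-mono-<-≤ (0<*0< {+ 2} (+<+ (s≤s z≤n)) (<⇒0<- (ℤₚ.≰⇒> ¬h)))
                      (0≤*0≤ (ℤₚ.i≤j⇒0≤j-i (+≤+ r≤1)) (ℤₚ.<⇒≤ (totPos⇒0<quad β (Reduced.pos₁ B)))))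
                    (identity (quad d β) (polar d β γ) (+ k) (+ r))
      where
      identity : ∀ q t k r → + 4 * t + q ≡ (r + (k + k)) * q + (+ 2 * (+ 2 * t - k * q) + (1ℤ - r) * q)
      identity = solve-∀

    -- From reduced bases to the norm bound

    module _ (squarefree : Squarefree D) where

      quad≡0⇒y≡0 : ∀ x y → quad d (x , y) ≡ 0ℤ → y ≡ 0ℤ
      quad≡0⇒y≡0 x y eq = ℤₚ.∣i∣≡0⇒i≡0 (irrational D 2≤D squarefree ∣ x ∣ ∣ y ∣
        (trans (sym (ℤₚ.abs-* x x)) (trans (cong ∣_∣ x²≡dy²)
          (trans (ℤₚ.abs-* d (y * y)) (cong (D ℕ.*_) (ℤₚ.abs-* y y))))))
        where
        x²≡dy² : x * x ≡ d * (y * y)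
        x²≡dy² = trans (ℤₚ.i-j≡0⇒i≡j (x * x) (d * y * y) eq) (ℤₚ.*-assoc d y y)

      quad≡0⇒x≡0 : ∀ x y → quad d (x , y) ≡ 0ℤ → x ≡ 0ℤ
      quad≡0⇒x≡0 x y eq with quad≡0⇒y≡0 x y eq
      ... | refl with ℤₚ.i*j≡0⇒i≡0∨j≡0 x (trans (ℤₚ.i-j≡0⇒i≡j (x * x) _ eq) (ℤₚ.*-zeroʳ (d * 0ℤ)))
      ...   | inj₁ x≡0 = x≡0
      ...   | inj₂ x≡0 = x≡0

      -- A positive value would make β - γ or γ - β totally positive. The value 0 would, by
      -- irrationality of √D, force β = γ and a vanishing determinant.
      quad-difference : ∀ {β γ} → Reduced β γ → quad d (β ⊝ γ) < 0ℤ
      quad-difference {β@(x , y)} {γ@(z , w)} B with ℤₚ.<-cmp (quad d (β ⊝ γ)) 0ℤ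
      ... | tri< q<0 _ _ = q<0
      ... | tri≈ _ q≡0 _ = ⊥-elim (det≢0 (Reduced.frame B) det≡0)
        where
        identity : ∀ x y z w → x * w - y * z ≡ (x + -1ℤ * z) * y - (y + -1ℤ * w) * x
        identity = solve-∀
        det≡0 : det β γ ≡ 0ℤ
        det≡0 = trans (identity x y z w) (cong₂ (λ a b → a * y - b * x)
          (quad≡0⇒x≡0 (x + -1ℤ * z) (y + -1ℤ * w) q≡0) (quad≡0⇒y≡0 (x + -1ℤ * z) (y + -1ℤ * w) q≡0))
      ... | tri> _ _ 0<q with 0<quad⇒totPos± (β ⊝ γ) 0<q
      ...   | inj₁ p = ⊥-elim (Reduced.¬β≻γ B p)
      ...   | inj₂ p = ⊥-elim (Reduced.¬γ≻β B (subst (TotPos D) (cong₂ _,_ (identity x z) (identity y w)) p))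
        where
        identity : ∀ x z → -1ℤ * (x + -1ℤ * z) ≡ z + -1ℤ * x
        identity = solve-∀

      module _ {β γ} (B : Reduced β γ) (n m t : ℤ) (Qβ≡ : quad d β ≡ + 4 * n) (Qγ≡ : quad d γ ≡ + 4 * m)
        (T≡ : polar d β γ ≡ + 2 * t) where

        open Reduced B
        x = proj₁ β
        y = proj₂ β
        z = proj₁ γ
        w = proj₂ γ
        Δ : ℤ
        Δ = + disc D

        unscale< : ∀ {a b} → + 4 * a < + 4 * b → a < b
        unscale< = ℤₚ.*-cancelˡ-<-nonNeg (+ 4)

        0<n : 0ℤ < n
        0<n = *-cancelˡ-0< {+ 4} (+≤+ z≤n) (subst (0ℤ <_) Qβ≡ (totPos⇒0<quad β pos₁))
        0<m : 0ℤ < m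
        0<m = *-cancelˡ-0< {+ 4} (+≤+ z≤n) (subst (0ℤ <_) Qγ≡ (totPos⇒0<quad γ pos₂))

        n+m<t : n + m < t
        n+m<t = unscale< (<-by _ (<⇒0<- (quad-difference B)) (trans (identity₁ n m t)
          (trans (cong₂ (λ a s → + 4 * (n + m) + (0ℤ - (a - + 2 * s))) (cong₂ _+_ (sym Qβ≡) (sym Qγ≡)) (sym T≡))
            (cong (λ q → + 4 * (n + m) + (0ℤ - q)) (identity₂ d x y z w)))))
          where
          identity₁ : ∀ n m t → + 4 * t ≡ + 4 * (n + m) + (0ℤ - ((+ 4 * n + + 4 * m) - + 2 * (+ 2 * t)))
          identity₁ = solve-∀
          identity₂ : ∀ d x y z w → (x * x - d * y * y) + (z * z - d * w * w) - + 2 * (x * z - d * y * w)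
            ≡ (x + -1ℤ * z) * (x + -1ℤ * z) - d * (y + -1ℤ * w) * (y + -1ℤ * w)
          identity₂ = solve-∀

        -- The Gram determinant of a ℤ-basis: the square of `polar` minus the product of the two
        -- `quad` values is D det², which the frame fixes as 4Δ.
        t²-4nm≡Δ : t * t - + 4 * (n * m) ≡ Δ
        t²-4nm≡Δ = ℤₚ.*-cancelˡ-≡ (+ 4) _ _ (trans (identity₁ n m t)
          (trans (cong₂ (λ a s → s * s - a) (cong₂ _*_ (sym Qβ≡) (sym Qγ≡)) (sym T≡))
            (trans (identity₂ d x y z w) det²)))
          where
          identity₁ : ∀ n m t → + 4 * (t * t - + 4 * (n * m)) ≡ (+ 2 * t) * (+ 2 * t) - (+ 4 * n) * (+ 4 * m)
          identity₁ = solve-∀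
          identity₂ : ∀ d x y z w →
            (x * z - d * y * w) * (x * z - d * y * w) - (x * x - d * y * y) * (z * z - d * w * w)
            ≡ d * ((x * w - y * z) * (x * w - y * z))
          identity₂ = solve-∀

        scaled : ∀ k {q s n} → q ≡ + 4 * n → s ≡ + 2 * t → k * q < + 4 * s + q → k * n ≤ᶻ + 2 * t + n
        scaled k {n = n} refl refl h = ℤₚ.<⇒≤ (unscale< (subst₂ _<_ (identity₁ k n) (identity₂ t n) h))
          where
          identity₁ : ∀ k n → k * (+ 4 * n) ≡ + 4 * (k * n)
          identity₁ = solve-∀
          identity₂ : ∀ t n → + 4 * (+ 2 * t) + + 4 * n ≡ + 4 * (+ 2 * t + n)
          identity₂ = solve-∀

        polar-comm : polar d γ β ≡ polar d β γ
        polar-comm = identity d x y z w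
          where
          identity : ∀ d x y z w → z * x - d * w * y ≡ x * z - d * y * w
          identity = solve-∀

        -- The division in `norm` rounds down, the favourable direction for an upper bound.
        norm≤ : ∀ e f → norm D (comb e β f γ) ≤ᶻ e * e * n + e * f * t + f * f * m
        norm≤ e f = ℤₚ.*-cancelʳ-≤-pos _ _ (+ 4) (subst (norm D α * + 4 ≤ᶻ_) quad≡ ([n/ℕd]*d≤n (quad d α) 4))
          where
          α = comb e β f γ
          identity₁ : ∀ d e f x y z w →
            (e * x + f * z) * (e * x + f * z) - d * (e * y + f * w) * (e * y + f * w)
            ≡ e * e * (x * x - d * y * y) + f * f * (z * z - d * w * w) + + 2 * (e * f) * (x * z - d * y * w)
          identity₁ = solve-∀
          identity₂ : ∀ e f n m t →
            e * e * (+ 4 * n) + f * f * (+ 4 * m) + + 2 * (e * f) * (+ 2 * t)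
            ≡ (e * e * n + e * f * t + f * f * m) * + 4
          identity₂ = solve-∀
          quad≡ : quad d α ≡ (e * e * n + e * f * t + f * f * m) * + 4
          quad≡ = begin
            quad d α ≡⟨ identity₁ d e f x y z w ⟩
            e * e * quad d β + f * f * quad d γ + + 2 * (e * f) * polar d β γ
              ≡⟨ cong₂ (λ q r → e * e * q + f * f * r + + 2 * (e * f) * polar d β γ) Qβ≡ Qγ≡ ⟩
            e * e * (+ 4 * n) + f * f * (+ 4 * m) + + 2 * (e * f) * polar d β γ
              ≡⟨ cong (λ s → e * e * (+ 4 * n) + f * f * (+ 4 * m) + + 2 * (e * f) * s) T≡ ⟩
            e * e * (+ 4 * n) + f * f * (+ 4 * m) + + 2 * (e * f) * (+ 2 * t)
              ≡⟨ identity₂ e f n m t ⟩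
            (e * e * n + e * f * t + f * f * m) * + 4 ∎
            where open ≡-Reasoning

        square-bound : ∀ e f → TotPos D (comb (+ e) β (+ f) γ) → PK≡2 D (comb (+ e) β (+ f) γ) →
          let M = norm D (comb (+ e) β (+ f) γ) - + 25 * Δ in
          0ℤ ≤ᶻ M → M * M < (+ 15 * Δ + + 10) * (+ 15 * Δ + + 10) * Δ
        square-bound e f p pk2 = subst
          (λ Δ → let M = norm D α - + 25 * Δ in 0ℤ ≤ᶻ M → M * M < (+ 15 * Δ + + 10) * (+ 15 * Δ + + 10) * Δ)
          t²-4nm≡Δ
          (NormEstimate.M²< n m t (+ e) (+ f) (norm D α) 0<n 0<m n+m<t (+≤+ z≤n) (+≤+ z≤n)
            (scaled (+ e) Qβ≡ T≡ (coefficient< B e f p refl pk2))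
            (scaled (+ f) Qγ≡ (trans polar-comm T≡)
              (coefficient< (swapReduced B) f e p (comb-swap (+ e) β (+ f) γ) pk2))
            (norm≤ (+ e) (+ f)))
          where
          α = comb (+ e) β (+ f) γ

      normBound : ∀ α → OKplus D α → PK≡2 D α → NormBound (disc D) (norm D α)
      normBound α α∈⁺ pk2 =
        let β , γ , B , e , f , eq = reducedFrame α α∈⁺
            n , Qβ≡ = quad-quadruple β (Reduced.inβ B)
            m , Qγ≡ = quad-quadruple γ (Reduced.inγ B)
            t , T≡ = polar-even β γ (Reduced.inβ B) (Reduced.inγ B)
        in intro-NormBound (disc D) (norm D α)
             (subst (λ α → let M = norm D α - + 25 * + disc D in
                       0ℤ ≤ᶻ M → M * M < (+ 15 * + disc D + + 10) * (+ 15 * + disc D + + 10) * + disc D) (sym eq)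
               (square-bound B n m t Qβ≡ Qγ≡ T≡ e f
                 (subst (TotPos D) eq (proj₂ α∈⁺)) (subst (PK≡2 D) eq pk2)))

theorem6p10 : (D : ℕ) → 2 ≤ D → Squarefree D →
    (α : Elt) → OKplus D α → PK≡2 D α → NormBound (disc D) (norm D α)
theorem6p10 D 2≤D squarefree = Order.normBound D 2≤D squarefree
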